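{- For every GCS $\mathcal{G}=(\mathit{Var},\mathit{Const},\mathit{Act},\Delta,\lambda)$ and every labeled transition system $T=(V,\mathit{Act},\to)$ with finite state set $V$, the maximal weak bisimulation $\approx$ between the transition system $T_{\mathcal{G}}$ of $\mathcal{G}$ and $T$ is effectively gap definable: for each state $s\in V$, the set $\{\nu\in\mathit{Val}\mid \nu\approx s\}$ is gap definable, and a gap formula defining it can be computed from $\mathcal{G}$, $T$ and $s$.
   Context: Fix finite sets $\mathit{Var}$ of variables and $\mathit{Const}\subseteq\mathbb{Z}$ of constants; valuations are maps $\nu:\mathit{Var}\to\mathbb{Z}$ (with $\nu(c)=c$ for constants), forming the set $\mathit{Val}$. A gap clause is $x-y\ge k$ with $x,y\in\mathit{Var}\cup\mathit{Const}$, $k\in\mathbb{Z}$ (positive if $k\in\mathbb{N}$), satisfied by $\nu$ iff $\nu(x)-\nu(y)\ge k$. A gap formula is a Boolean combination of gap clauses; a set of valuations is gap definable if it is the set of valuations satisfying some gap formula. A GCS $\mathcal{G}=(\mathit{Var},\mathit{Const},\mathit{Act},\Delta,\lambda)$ consists of a finite action set $\mathit{Act}$, a finite set $\Delta$ of positive gap constraints (finite conjunctions of positive gap clauses) over $\mathit{Var}\cup\mathit{Var}'\cup\mathit{Const}$ where $\mathit{Var}'=\{x'\mid x\in\mathit{Var}\}$, and $\lambda:\Delta\to\mathit{Act}$; its transition system $T_{\mathcal{G}}$ has states $\mathit{Val}$ and $\nu\xrightarrow{a}\nu'$ iff the assignment $x\mapsto\nu(x)$, $x'\mapsto\nu'(x)$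 satisfies some $C\in\Delta$ with $\lambda(C)=a$. A dedicated action $\tau\in\mathit{Act}$ is unobservable; weak steps are $\stackrel{\tau}{\Rightarrow}=(\xrightarrow{\tau})^*$ and $\stackrel{a}{\Rightarrow}=(\xrightarrow{\tau})^*\cdot\xrightarrow{a}\cdot(\xrightarrow{\tau})^*$ for $a\neq\tau$. A relation $R$ on states of an LTS is a weak bisimulation if $sRt$ implies: for every $s\stackrel{a}{\Rightarrow}s'$ there is $t\stackrel{a}{\Rightarrow}t'$ with $s'Rt'$, and for every $t\stackrel{a}{\Rightarrow}t'$ there is $s\stackrel{a}{\Rightarrow}s'$ with $s'Rt'$. The maximal weak bisimulation between two LTS is the largest weak bisimulation on their disjoint union, projected to pairs with one component from each system. -}

module Defs where

open import Data.Nat using (ℕ)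
open import Data.Integer using (ℤ; +_; _-_; _≤_)
open import Data.Fin using (Fin)
open import Data.Bool using (Bool; true)
open import Data.List using (List)
open import Data.List.Relation.Unary.All using (All)
open import Data.List.Relation.Unary.Any using (Any)
open import Data.Product using (_×_; _,_; Σ; ∃)
open import Data.Sum using (_⊎_; inj₁; inj₂)
open import Data.Unit using (⊤)
open import Data.Empty using (⊥)
open import Relation.Nullary using (¬_)
open import Relation.Binary.PropositionalEquality using (_≡_)
open import Relation.Binary.Construct.Closure.ReflexiveTransitive using (Star)
open import Level using (Level; suc; _⊔_) renaming (zero to lzero)

-- Variables Var = Fin nV, constants Const given by an enumeration
-- cs : Fin nC → ℤ (a finite subset of ℤ), actions Act = Fin nA.

Val : ℕ → Set
Val nV = Fin nV → ℤ

data Term (nV nC : ℕ) : Set where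
  var : Fin nV → Term nV nC
  cst : Fin nC → Term nV nC

⟦_⟧ₜ : ∀ {nV nC} → Term nV nC → (Fin nC → ℤ) → Val nV → ℤ
⟦ var x ⟧ₜ cs ν = ν x
⟦ cst c ⟧ₜ cs ν = cs c

data GapFormula (nV nC : ℕ) : Set where
  gap  : Term nV nC → Term nV nC → ℤ → GapFormula nV nC
  tt   : GapFormula nV nC
  ¬ᶠ_  : GapFormula nV nC → GapFormula nV nC
  _∧ᶠ_ : GapFormula nV nC → GapFormula nV nC → GapFormula nV nC
  _∨ᶠ_ : GapFormula nV nC → GapFormula nV nC → GapFormula nV nC

Sat : ∀ {nV nC} → (Fin nC → ℤ) → Val nV → GapFormula nV nC → Set
Sat cs ν (gap x y k) = k ≤ (⟦ x ⟧ₜ cs ν - ⟦ y ⟧ₜ cs ν)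
Sat cs ν tt = ⊤
Sat cs ν (¬ᶠ φ) = ¬ Sat cs ν φ
Sat cs ν (φ ∧ᶠ ψ) = Sat cs ν φ × Sat cs ν ψ
Sat cs ν (φ ∨ᶠ ψ) = Sat cs ν φ ⊎ Sat cs ν ψ

data Term₂ (nV nC : ℕ) : Set where
  cur : Fin nV → Term₂ nV nC
  nxt : Fin nV → Term₂ nV nC
  cst : Fin nC → Term₂ nV nC

record PosClause (nV nC : ℕ) : Set where
  constructor _−_≥_
  field
    left  : Term₂ nV nC
    right : Term₂ nV nC
    bound : ℕ

PosConstraint : ℕ → ℕ → Set
PosConstraint nV nC = List (PosClause nV nC)

record GCS (nA : ℕ) : Set where
  field
    nV : ℕ
    nC : ℕ
    consts : Fin nC → ℤ
    Δλ : List (PosConstraint nV nC × Fin nA) -- Δ together with labelling λ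

⟦_⟧₂ : ∀ {nV nC} → Term₂ nV nC → (Fin nC → ℤ) → Val nV → Val nV → ℤ
⟦ cur x ⟧₂ cs ν ν' = ν x
⟦ nxt x ⟧₂ cs ν ν' = ν' x
⟦ cst c ⟧₂ cs ν ν' = cs c

SatClause : ∀ {nV nC} → (Fin nC → ℤ) → Val nV → Val nV → PosClause nV nC → Set
SatClause cs ν ν' (x − y ≥ k) = + k ≤ (⟦ x ⟧₂ cs ν ν' - ⟦ y ⟧₂ cs ν ν')

SatConstraint : ∀ {nV nC} → (Fin nC → ℤ) → Val nV → Val nV → PosConstraint nV nC → Set
SatConstraint cs ν ν' C = All (SatClause cs ν ν') C

record LTS (ℓ : Level) (nA : ℕ) : Set (suc ℓ) where
  field
    State : Set ℓ
    step  : Fin nA → State → State → Set ℓ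

T⟦_⟧ : ∀ {nA} → GCS nA → LTS lzero nA
T⟦ G ⟧ = record
  { State = Val nV
  ; step  = λ a ν ν' → Any (λ Cl → (SatConstraint consts ν ν' (Data.Product.proj₁ Cl))
                                 × (Data.Product.proj₂ Cl ≡ a)) Δλ }
  where open GCS G

record FinLTS (nA : ℕ) : Set where
  field
    m   : ℕ
    trans : Fin nA → Fin m → Fin m → Bool

FinLTS→LTS : ∀ {nA} → FinLTS nA → LTS lzero nA
FinLTS→LTS T = record
  { State = Fin m ; step = λ a s t → trans a s t ≡ true }
  where open FinLTS T

_⊎ᴸ_ : ∀ {nA} → LTS lzero nA → LTS lzero nA → LTS lzero nA
L₁ ⊎ᴸ L₂ = record { State = LTS.State L₁ ⊎ LTS.State L₂ ; step = st }
  where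
  st : _ → LTS.State L₁ ⊎ LTS.State L₂ → LTS.State L₁ ⊎ LTS.State L₂ → Set
  st a (inj₁ x) (inj₁ y) = LTS.step L₁ a x y
  st a (inj₂ x) (inj₂ y) = LTS.step L₂ a x y
  st a _ _ = ⊥

module Weak {nA : ℕ} (τ : Fin nA) (L : LTS lzero nA) where
  open LTS L

  _⇒τ_ : State → State → Set
  _⇒τ_ = Star (step τ)

  WeakStep : Fin nA → State → State → Set
  WeakStep a s t with a Data.Fin.≟ τ
  ... | Relation.Nullary.yes _ = s ⇒τ t
  ... | Relation.Nullary.no  _ =
        Σ State λ s₁ → Σ State λ t₁ → (s ⇒τ s₁) × step a s₁ t₁ × (t₁ ⇒τ t)

  IsWeakBisim : (State → State → Set) → Set
  IsWeakBisim R = ∀ s t → R s t →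
      (∀ a s' → WeakStep a s s' → Σ State λ t' → WeakStep a t t' × R s' t')
    × (∀ a t' → WeakStep a t t' → Σ State λ s' → WeakStep a s s' × R s' t')

  _≈_ : State → State → Set₁
  s ≈ t = Σ (State → State → Set) λ R → IsWeakBisim R × R s t

WeakBisimilar : ∀ {nA} (τ : Fin nA) (G : GCS nA) (T : FinLTS nA) →
                Val (GCS.nV G) → Fin (FinLTS.m T) → Set₁
WeakBisimilar τ G T ν s = Weak._≈_ τ (T⟦ G ⟧ ⊎ᴸ FinLTS→LTS T) (inj₁ ν) (inj₂ s)

module Submission where

-- Positive gap constraints over (ν′ , ν) are closed under relational composition, because
-- eliminating a variable from a conjunction of difference constraints adds up bounds and so keeps
-- them non-negative.  Pointwise comparison of the bounds is an almost full relation, hence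
-- saturating the transition constraints under composition terminates: the transitive closure of
-- the steps is a finite union of positive gap constraints, and weak predecessors of gap definable
-- sets are gap definable.  Therefore so are all the approximants ~ₙ of weak bisimilarity with a
-- state of T.  Since T is finite, ~ₖ and ~ₖ₊₁ agree on T for some k; then ν ≈ s iff ν ~ₖ s and
-- every state reachable from ν is related by ~ₖ₊₁ to some state of T.

open import Defs
open import Data.Bool using (true)
import Data.Bool as Bool
open import Data.Empty using (⊥; ⊥-elim)
open import Data.Fin as Fin using (Fin; zero; suc)
import Data.Fin.Properties as Fin
open import Data.Integer using (ℤ; +_; ∣_∣; 0ℤ; 1ℤ; _+_; _-_; _≤_; _≤?_; +≤+)
import Data.Integer.Properties as ℤ
open import Data.Integer.Tactic.RingSolver using (solve-∀)
open import Data.List using (List; []; _∷_; _++_; map; concatMap; cartesianProduct;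
  cartesianProductWith; allFin; foldr; filter; length)
open import Data.List.Extrema ℤ.≤-totalOrder using (max; min; xs≤max; min≤xs; max≤v⁺)
open import Data.List.Membership.Propositional using (_∈_; find; lose)
open import Data.List.Membership.Propositional.Properties
open import Data.List.Properties using (filter-notAll)
open import Data.List.Relation.Binary.Subset.Propositional using (_⊆_)
open import Data.List.Relation.Binary.Subset.Propositional.Properties using (Any-resp-⊆)
open import Data.List.Relation.Unary.All as All using (All; []; _∷_)
import Data.List.Relation.Unary.All.Properties as All
open import Data.List.Relation.Unary.Any as Any using (Any; here; there)
import Data.List.Relation.Unary.Any.Properties as Any
open import Data.Maybe using (Maybe; just; nothing; maybe′)
open import Data.Nat as ℕ using (ℕ; zero; suc; z≤n)
open import Data.Nat.Induction using (<-wellFounded)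
import Data.Nat.Properties as ℕ
open import Data.Product using (Σ; ∃; _×_; _,_; proj₁; proj₂; uncurry; map₁; map₂)
import Data.Product.Properties as Product
open import Data.Sum as Sum using (_⊎_; inj₁; inj₂; [_,_]′)
import Data.Sum.Properties as Sum
open import Data.Unit using (⊤)
import Data.Vec.Functional as Vector
open import Function using (_∘_; id)
open import Function.Bundles using (_⇔_; mk⇔; Equivalence)
open import Function.Construct.Composition using (_⇔-∘_)
open import Induction.WellFounded using (Acc; acc)
open import Level using () renaming (zero to 0ℓ)
open import Relation.Binary.Construct.Closure.ReflexiveTransitive using (Star; ε; _◅_; _◅◅_; gmap)
open import Relation.Binary.Construct.Closure.Transitive using (TransClosure; [_]; _∷_)
open import Relation.Binary.Definitions using (DecidableEquality)
open import Relation.Binary.PropositionalEquality using (_≡_; _≗_; refl; sym; cong₂; subst; setoid)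
open import Relation.Nullary using (¬_; Dec; yes; no)
open import Relation.Nullary.Decidable using (map′; _×-dec_; _→-dec_; decidable-stable; ¬?)
open import Relation.Unary using (Decidable)

open Equivalence using (to; from)

-- Almost full relations and their closure under intersection.

-- The inductive, constructively usable form of a well-quasi-order.
data AlmostFull {X : Set} (R : X → X → Set) : Set where
  now   : (∀ x y → R x y) → AlmostFull R
  later : (∀ x → AlmostFull (λ y z → R y z ⊎ R x y)) → AlmostFull R

module _ {X : Set} where

  AF-mono : {R S : X → X → Set} → (∀ {x y} → R x y → S x y) → AlmostFull R → AlmostFull S
  AF-mono R⊆S (now r)   = now λ x y → R⊆S (r x y)
  AF-mono R⊆S (later r) = later λ x → AF-mono [ inj₁ ∘ R⊆S , inj₂ ∘ R⊆S ]′ (r x)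

  private
    pair : {C A B : Set} → C ⊎ A → C ⊎ B → C ⊎ A × B
    pair (inj₁ c) _        = inj₁ c
    pair (inj₂ a) (inj₁ c) = inj₁ c
    pair (inj₂ a) (inj₂ b) = inj₂ (a , b)

    absorb : {R R′ C C′ A A′ : Set} → (R → C ⊎ A) → (R′ → C′ ⊎ A′) →
             R ⊎ R′ → ((C ⊎ C′) ⊎ A′) ⊎ A
    absorb f g (inj₁ r) = [ inj₁ ∘ inj₁ ∘ inj₁ , inj₂ ]′ (f r)
    absorb f g (inj₂ r) = inj₁ ([ inj₁ ∘ inj₂ , inj₂ ]′ (g r))

    widen : {R C C′ A′ A : Set} → (R → C ⊎ A) → R → ((C ⊎ C′) ⊎ A′) ⊎ A
    widen f = [ inj₁ ∘ inj₁ ∘ inj₁ , inj₂ ]′ ∘ f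

    swapʳ : {C A P : Set} → (C ⊎ A) ⊎ P → (C ⊎ P) ⊎ A
    swapʳ (inj₁ (inj₁ c)) = inj₁ (inj₁ c)
    swapʳ (inj₁ (inj₂ a)) = inj₂ a
    swapʳ (inj₂ p)        = inj₁ (inj₂ p)

    middle : {C C′ P Q : Set} → ((C ⊎ C′) ⊎ P) ⊎ Q → (C ⊎ P) ⊎ (C′ ⊎ Q)
    middle (inj₁ (inj₁ (inj₁ c))) = inj₁ (inj₁ c)
    middle (inj₁ (inj₁ (inj₂ c))) = inj₂ (inj₁ c)
    middle (inj₁ (inj₂ p))        = inj₁ (inj₂ p)
    middle (inj₂ q)               = inj₂ (inj₂ q)

  -- Intersections with conditions of arity 0, 1 and 2, each obtained from the previous arity: fixing
  -- the first point x turns a condition on (x , y) into one on y alone.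
  AF-×₀ : {R S C : X → X → Set} {A B : Set} → AlmostFull R → AlmostFull S →
          (∀ {x y} → R x y → C x y ⊎ A) → (∀ {x y} → S x y → C x y ⊎ B) →
          AlmostFull (λ x y → C x y ⊎ A × B)
  AF-×₀ (now r)   S f g = AF-mono (λ s → pair (f (r _ _)) (g s)) S
  AF-×₀ {C = C} (later r) S f g = later λ x →
    AF-mono [ [ inj₁ ∘ inj₁ , inj₂ ∘ inj₁ ]′ , inj₁ ∘ inj₂ ]′
      (AF-×₀ {C = λ y z → C y z ⊎ C x y} (r x) S
        [ [ inj₁ ∘ inj₁ , inj₂ ]′ ∘ f , [ inj₁ ∘ inj₂ , inj₂ ]′ ∘ f ]′
        ([ inj₁ ∘ inj₁ , inj₂ ]′ ∘ g))

  AF-×₁ : {R S C : X → X → Set} {A B : X → Set} → AlmostFull R → AlmostFull S →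
          (∀ {x y} → R x y → C x y ⊎ A x) → (∀ {x y} → S x y → C x y ⊎ B x) →
          AlmostFull (λ x y → C x y ⊎ A x × B x)
  AF-×₁ (now r) S f g = AF-mono (λ s → pair (f (r _ _)) (g s)) S
  AF-×₁ R (now s) f g = AF-mono (λ r → pair (f r) (g (s _ _))) R
  -- `C` stores the disjuncts already obtained. Each inner call consumes one of `r`, `s` and keeps
  -- the other; its leftover, `A x` or `B x`, mentions only the fixed `x`, so `AF-×₀` can combine
  -- the two. `AF-×₂` descends to `AF-×₁` in the same way.
  AF-×₁ {C = C} {A} {B} (later r) (later s) f g = later λ x →
    AF-mono middle
      (AF-×₀ {C = λ y z → (C y z ⊎ C x y) ⊎ A y × B y}
        (AF-×₁ {C = λ y z → (C y z ⊎ C x y) ⊎ A x} (r x) (later s) (absorb f f) (widen g))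
        (AF-×₁ {C = λ y z → (C y z ⊎ C x y) ⊎ B x} (later r) (s x) (widen f) (absorb g g))
        swapʳ swapʳ)

  AF-×₂ : {R S C A B : X → X → Set} → AlmostFull R → AlmostFull S →
          (∀ {x y} → R x y → C x y ⊎ A x y) → (∀ {x y} → S x y → C x y ⊎ B x y) →
          AlmostFull (λ x y → C x y ⊎ A x y × B x y)
  AF-×₂ (now r) S f g = AF-mono (λ s → pair (f (r _ _)) (g s)) S
  AF-×₂ R (now s) f g = AF-mono (λ r → pair (f r) (g (s _ _))) R
  AF-×₂ {C = C} {A} {B} (later r) (later s) f g = later λ x →
    AF-mono middle
      (AF-×₁ {C = λ y z → (C y z ⊎ C x y) ⊎ A y z × B y z}
        (AF-×₂ {C = λ y z → (C y z ⊎ C x y) ⊎ A x y} (r x) (later s) (absorb f f) (widen g))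
        (AF-×₂ {C = λ y z → (C y z ⊎ C x y) ⊎ B x y} (later r) (s x) (widen f) (absorb g g))
        swapʳ swapʳ)

  AF-∩ : {R S : X → X → Set} → AlmostFull R → AlmostFull S → AlmostFull (λ x y → R x y × S x y)
  AF-∩ R S = AF-mono [ ⊥-elim , id ]′ (AF-×₂ {C = λ _ _ → ⊥} R S inj₂ inj₂)

  -- After a first point of value `n`, only points of value below `n` can still escape a comparison
  -- with it; `below` is the induction on `n`.
  AF-≤ : (f : X → ℕ) → AlmostFull (λ x y → f x ℕ.≤ f y)
  AF-≤ f = later (below ∘ f)
    where
    below : ∀ n → AlmostFull (λ y z → f y ℕ.≤ f z ⊎ n ℕ.≤ f y)
    below zero    = now λ _ _ → inj₂ z≤n
    below (suc n) = later step
      where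
      step : ∀ x →
        AlmostFull (λ y z → (f y ℕ.≤ f z ⊎ suc n ℕ.≤ f y) ⊎ (f x ℕ.≤ f y ⊎ suc n ℕ.≤ f x))
      step x with n ℕ.<? f x
      ... | yes n<fx = now λ _ _ → inj₂ (inj₂ n<fx)
      -- Here `f x ≤ n`, so the alternative `n ≤ f y` of the induction hypothesis gives `f x ≤ f y`.
      ... | no  n≮fx = AF-mono [ inj₁ ∘ inj₁ , inj₂ ∘ inj₁ ∘ ℕ.≤-trans (ℕ.≮⇒≥ n≮fx) ]′ (below n)

  AF-All : {I : Set} (f : I → X → ℕ) (is : List I) →
           AlmostFull (λ x y → All (λ i → f i x ℕ.≤ f i y) is)
  AF-All f []       = now λ _ _ → []
  AF-All f (i ∷ is) = AF-mono (λ (p , ps) → p ∷ ps) (AF-∩ (AF-≤ (f i)) (AF-All f is))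

-- Saturation of a finite list up to covering.

module Saturation {X : Set} (_≼_ : X → X → Set) (_≼?_ : ∀ x y → Dec (x ≼ y))
                  (≼-refl : ∀ {x} → x ≼ x) where

  Covers : List X → X → Set
  Covers D x = Any (_≼ x) D

  -- Well-foundedness of extending a list by an uncovered element. This is the termination measure
  -- of saturation.
  data Bar (D : List X) : Set where
    bar : (∀ x → ¬ Covers D x → Bar (x ∷ D)) → Bar D

  AF⇒Bar : AlmostFull _≼_ → Bar []
  AF⇒Bar af = go af inj₁
    where
    -- Invariant: `R` is at most `≼` weakened by the coverage of its first argument by the points
    -- chosen so far. Choosing a further uncovered `x` refutes the coverage of `x`, and the new
    -- disjunct `R x y` becomes the coverage of `y` by `x`.
    go : ∀ {R : X → X → Set} {D} → AlmostFull R → (∀ {x y} → R x y → x ≼ y ⊎ Covers D x) → Bar D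
    go (now r) f = bar λ x ¬x → bar λ y ¬y →
      ⊥-elim ([ ¬y ∘ here , ¬x ]′ (f (r x y)))
    go (later r) f = bar λ x ¬x → go (r x)
      [ [ inj₁ , inj₂ ∘ there ]′ ∘ f , [ inj₂ ∘ here , ⊥-elim ∘ ¬x ]′ ∘ f ]′

  module _ (next : X → List X) {P : X → Set} (P-next : ∀ {x} → P x → All P (next x)) where

    record Saturated (init : List X) : Set where
      field
        elements  : List X
        invariant : All P elements
        initial   : ∀ {x} → x ∈ init → Covers elements x
        closed    : ∀ {x y} → x ∈ elements → y ∈ next x → Covers elements y

    private
      go : ∀ {D} todo → Bar D → All P D → All P todo →
           (∀ {x y} → x ∈ D → y ∈ next x → Covers D y ⊎ y ∈ todo) →
           Σ (Saturated todo) λ S → D ⊆ Saturated.elements S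
      go {D} [] b pD _ cl = record
        { elements = D ; invariant = pD ; initial = λ ()
        ; closed = λ x∈D y∈ → [ id , (λ ()) ]′ (cl x∈D y∈) } , id
      go {D} (x ∷ todo) b pD (px ∷ ps) cl with Any.any? (_≼? x) D
      ... | yes cov = record
        { elements = elements ; invariant = invariant ; closed = closed
        ; initial = λ { (here refl) → Any-resp-⊆ D⊆ cov ; (there y∈) → initial y∈ } } , D⊆
        where
        todo-or-covered : ∀ {y} → Covers D y ⊎ y ∈ x ∷ todo → Covers D y ⊎ y ∈ todo
        todo-or-covered (inj₁ c)           = inj₁ c
        todo-or-covered (inj₂ (here refl)) = inj₁ cov
        todo-or-covered (inj₂ (there y∈))  = inj₂ y∈

        rec = go todo b pD ps λ x∈D → todo-or-covered ∘ cl x∈D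
        D⊆  = proj₂ rec
        open Saturated (proj₁ rec)
      go {D} (x ∷ todo) (bar b) pD (px ∷ ps) cl | no ¬cov = record
        { elements = elements ; invariant = invariant ; closed = closed
        ; initial = λ { (here refl) → lose (xD⊆ (here refl)) ≼-refl
                      ; (there y∈)  → initial (Any.++⁺ʳ (next x) y∈) } } , xD⊆ ∘ there
        where
        todo-or-covered : ∀ {y} → Covers D y ⊎ y ∈ x ∷ todo →
                          Covers (x ∷ D) y ⊎ y ∈ next x ++ todo
        todo-or-covered (inj₁ c)           = inj₁ (there c)
        todo-or-covered (inj₂ (here refl)) = inj₁ (here ≼-refl)
        todo-or-covered (inj₂ (there y∈))  = inj₂ (Any.++⁺ʳ (next x) y∈)

        closed′ : ∀ {z y} → z ∈ x ∷ D → y ∈ next z → Covers (x ∷ D) y ⊎ y ∈ next x ++ todo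
        closed′ (here refl) y∈ = inj₂ (Any.++⁺ˡ y∈)
        closed′ (there z∈)  y∈ = todo-or-covered (cl z∈ y∈)

        rec = go (next x ++ todo) (b x ¬cov) (px ∷ pD) (All.++⁺ (P-next px) ps) closed′
        xD⊆ = proj₂ rec
        open Saturated (proj₁ rec)

    saturate : ∀ init → Bar [] → All P init → Saturated init
    saturate init b ps = proj₁ (go init b [] ps λ ())

-- Difference constraints and elimination of variables.

record Clause (A : Set) : Set where
  constructor clause
  field
    lhs rhs : A
    bound   : ℤ
open Clause

Conj DNF : Set → Set
Conj A = List (Clause A)
DNF A  = List (Conj A)

private
  variable
    A B : Set

_⊨_ : (A → ℤ) → Clause A → Set
ρ ⊨ c = bound c ≤ ρ (lhs c) - ρ (rhs c)

_⊨*_ : (A → ℤ) → Conj A → Set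
ρ ⊨* C = All (ρ ⊨_) C

-- A separate predicate on integer bounds, because negation makes bounds negative and the same
-- elimination serves step constraints and arbitrary gap definable sets.
Positive : Conj A → Set
Positive C = All (λ c → 0ℤ ≤ bound c) C

rename : (A → B) → Conj A → Conj B
rename f = map λ c → clause (f (lhs c)) (f (rhs c)) (bound c)

⊨*-rename : (f : A → B) (ρ : B → ℤ) (σ : A → ℤ) → ρ ∘ f ≗ σ → ∀ {C} → ρ ⊨* rename f C ⇔ σ ⊨* C
⊨*-rename f ρ σ eq = mk⇔
  (All.map (λ {c} → subst (bound c ≤_) (values c)) ∘ All.map⁻)
  (All.map⁺ ∘ All.map (λ {c} → subst (bound c ≤_) (sym (values c))))
  where
  values : ∀ c → ρ (f (lhs c)) - ρ (f (rhs c)) ≡ σ (lhs c) - σ (rhs c)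
  values c = cong₂ _-_ (eq (lhs c)) (eq (rhs c))

interpolate : ∀ ls us → All (λ l → All (l ≤_) us) ls → ∃ λ z → All (_≤ z) ls × All (z ≤_) us
-- The default `min 0ℤ us` of the maximum lies below every upper bound, so it never breaks one, and
-- it is the witness when `ls` is empty.
interpolate ls us ls≤us = max (min 0ℤ us) ls , xs≤max _ ls , All.tabulate λ u∈us →
  max≤v⁺ (All.lookup (min≤xs 0ℤ us) u∈us) (All.map (λ l≤us → All.lookup l≤us u∈us) ls≤us)

module Bounds where

  -- A lower bound (y , k) says z ≥ y + k, an upper bound (x , k) says z ≤ x - k.
  lowers uppers : Conj (Maybe A) → List (A × ℤ)
  lowers []                                = []
  lowers (clause nothing  (just y) k ∷ C)  = (y , k) ∷ lowers C
  lowers (_ ∷ C)                           = lowers C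

  uppers []                                = []
  uppers (clause (just x) nothing  k ∷ C)  = (x , k) ∷ uppers C
  uppers (_ ∷ C)                           = uppers C

  loops : Conj (Maybe A) → List ℤ
  loops []                                 = []
  loops (clause nothing  nothing  k ∷ C)   = k ∷ loops C
  loops (_ ∷ C)                            = loops C

  others : Conj (Maybe A) → Conj A
  others []                                = []
  others (clause (just x) (just y) k ∷ C)  = clause x y k ∷ others C
  others (_ ∷ C)                           = others C

  record Split (ρ : A → ℤ) (z : ℤ) (C : Conj (Maybe A)) : Set where
    constructor split
    field
      lower : All (λ (y , k) → k + ρ y ≤ z) (lowers C)
      upper : All (λ (x , k) → z ≤ ρ x - k) (uppers C)
      loop  : All (_≤ 0ℤ) (loops C)
      other : ρ ⊨* others C

  ≤-shift : ∀ {a b c d} → b - a ≡ d - c → a ≤ b → c ≤ d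
  ≤-shift eq a≤b = ℤ.0≤i-j⇒j≤i (subst (0ℤ ≤_) eq (ℤ.i≤j⇒0≤j-i a≤b))

  -‿-‿swap : ∀ i j k → j - k - i ≡ j - i - k
  -‿-‿swap = solve-∀

  -‿-‿assoc : ∀ i j k → j - k - i ≡ j - (i + k)
  -‿-‿assoc = solve-∀

  -‿+‿interchange : ∀ k l x y → x - y - (k + l) ≡ x - l - (k + y)
  -‿+‿interchange = solve-∀

  i≤j-k⇒i+k≤j : ∀ i j k → i ≤ j - k → i + k ≤ j
  i≤j-k⇒i+k≤j i j k = ≤-shift (-‿-‿assoc i j k)

  i+k≤j⇒i≤j-k : ∀ i j k → i + k ≤ j → i ≤ j - k
  i+k≤j⇒i≤j-k i j k = ≤-shift (sym (-‿-‿assoc i j k))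

  i≤j-k⇒k≤j-i : ∀ i j k → i ≤ j - k → k ≤ j - i
  i≤j-k⇒k≤j-i i j k = ≤-shift (-‿-‿swap i j k)

  unsplit : ∀ {ρ : A → ℤ} {z} C → Split ρ z C → maybe′ ρ z ⊨* C
  unsplit [] _ = []
  unsplit (clause (just x) (just y) k ∷ C) (split l u s (o ∷ os)) = o ∷ unsplit C (split l u s os)
  unsplit {ρ = ρ} {z} (clause (just x) nothing  k ∷ C) (split l (u ∷ us) s o) =
    i≤j-k⇒k≤j-i z (ρ x) k u ∷ unsplit C (split l us s o)
  unsplit (clause nothing  (just y) k ∷ C) (split (l ∷ ls) u s o) =
    i+k≤j⇒i≤j-k k _ _ l ∷ unsplit C (split ls u s o)
  unsplit {z = z} (clause nothing nothing k ∷ C) (split l u (s ∷ ss) o) =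
    subst (k ≤_) (sym (ℤ.+-inverseʳ z)) s ∷ unsplit C (split l u ss o)

  split* : ∀ {ρ : A → ℤ} {z} C → maybe′ ρ z ⊨* C → Split ρ z C
  split* [] [] = split [] [] [] []
  split* (clause (just x) (just y) k ∷ C) (h ∷ hs) =
    let split l u s o = split* C hs in split l u s (h ∷ o)
  split* {ρ = ρ} {z} (clause (just x) nothing  k ∷ C) (h ∷ hs) =
    let split l u s o = split* C hs in split l (i≤j-k⇒k≤j-i k (ρ x) z h ∷ u) s o
  split* (clause nothing  (just y) k ∷ C) (h ∷ hs) =
    let split l u s o = split* C hs in split (i≤j-k⇒i+k≤j k _ _ h ∷ l) u s o
  split* {z = z} (clause nothing nothing k ∷ C) (h ∷ hs) =
    let split l u s o = split* C hs in split l u (subst (k ≤_) (ℤ.+-inverseʳ z) h ∷ s) o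

  chain : A × ℤ → A × ℤ → Clause A
  chain (y , k) (x , l) = clause x y (k + l)

  -- Fourier-Motzkin elimination of the variable `nothing`, exact over the integers because all
  -- coefficients are 1 or -1. A clause from `nothing` to itself only says `k ≤ 0`, so the loops
  -- decide between one disjunct and none.
  eliminate : Conj (Maybe A) → DNF A
  eliminate C with All.all? (_≤? 0ℤ) (loops C)
  ... | yes _ = (cartesianProductWith chain (lowers C) (uppers C) ++ others C) ∷ []
  ... | no  _ = []

  -- The chained clauses say that every lower bound is at most every upper bound, which is the
  -- hypothesis of `interpolate`.
  eliminate-sound : ∀ (ρ : A → ℤ) C → Any (ρ ⊨*_) (eliminate C) → ∃ λ z → maybe′ ρ z ⊨* C
  eliminate-sound ρ C p with All.all? (_≤? 0ℤ) (loops C)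
  eliminate-sound ρ C (here p) | yes loop =
    let chains , other = All.++⁻ (cartesianProductWith chain (lowers C) (uppers C)) p
        z , lower , upper = interpolate
          (map (λ (y , k) → k + ρ y) (lowers C)) (map (λ (x , k) → ρ x - k) (uppers C))
          (All.map⁺ (All.tabulate λ {(y , k)} l∈ → All.map⁺ (All.tabulate λ {(x , l)} u∈ →
            ≤-shift (-‿+‿interchange k l (ρ x) (ρ y))
              (All.lookup chains (∈-cartesianProductWith⁺ chain l∈ u∈)))))
    in z , unsplit C (split (All.map⁻ lower) (All.map⁻ upper) loop other)

  eliminate-complete : ∀ (ρ : A → ℤ) z C → maybe′ ρ z ⊨* C → Any (ρ ⊨*_) (eliminate C)
  eliminate-complete ρ z C p with split* C p | All.all? (_≤? 0ℤ) (loops C)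
  ... | split _ _ loop _         | no ¬loop = ⊥-elim (¬loop loop)
  ... | split lower upper _ other | yes _   = here (All.++⁺
    (All.cartesianProductWith⁺ (setoid _) (setoid _) chain (lowers C) (uppers C)
      λ {(y , k)} {(x , l)} l∈ u∈ →
      ≤-shift (sym (-‿+‿interchange k l (ρ x) (ρ y)))
        (ℤ.≤-trans (All.lookup lower l∈) (All.lookup upper u∈)))
    other)

  positive-split : ∀ (C : Conj (Maybe A)) → Positive C →
    All (λ (_ , k) → 0ℤ ≤ k) (lowers C) × All (λ (_ , k) → 0ℤ ≤ k) (uppers C) × Positive (others C)
  positive-split [] [] = [] , [] , []
  positive-split (clause (just x) (just y) k ∷ C) (p ∷ ps) =
    let l , u , o = positive-split C ps in l , u , p ∷ o
  positive-split (clause (just x) nothing k ∷ C) (p ∷ ps) =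
    let l , u , o = positive-split C ps in l , p ∷ u , o
  positive-split (clause nothing (just y) k ∷ C) (p ∷ ps) =
    let l , u , o = positive-split C ps in p ∷ l , u , o
  positive-split (clause nothing nothing k ∷ C) (p ∷ ps) = positive-split C ps

  eliminate-positive : ∀ (C : Conj (Maybe A)) → Positive C → All Positive (eliminate C)
  eliminate-positive C p with All.all? (_≤? 0ℤ) (loops C)
  ... | no  _ = []
  ... | yes _ = let l , u , o = positive-split C p in
    All.++⁺ (All.cartesianProductWith⁺ (setoid _) (setoid _) chain (lowers C) (uppers C)
      λ l∈ u∈ → ℤ.+-mono-≤ (All.lookup l l∈) (All.lookup u u∈)) o ∷ []

open Bounds using (eliminate; eliminate-sound; eliminate-complete; eliminate-positive)

module _ {A : Set} where

  split-first : ∀ {n} → Fin (suc n) ⊎ A → Maybe (Fin n ⊎ A)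
  split-first (inj₁ zero)    = nothing
  split-first (inj₁ (suc i)) = just (inj₁ i)
  split-first (inj₂ a)       = just (inj₂ a)

  split-first-env : ∀ {n} (μ : Fin (suc n) → ℤ) (ρ : A → ℤ) →
    maybe′ [ μ ∘ suc , ρ ]′ (μ zero) ∘ split-first ≗ [ μ , ρ ]′
  split-first-env μ ρ (inj₁ zero)    = refl
  split-first-env μ ρ (inj₁ (suc i)) = refl
  split-first-env μ ρ (inj₂ a)       = refl

  ⊨*-split-first : ∀ {n} (μ : Fin (suc n) → ℤ) (ρ : A → ℤ) {C} →
    maybe′ [ μ ∘ suc , ρ ]′ (μ zero) ⊨* rename split-first C ⇔ [ μ , ρ ]′ ⊨* C
  ⊨*-split-first μ ρ =
    ⊨*-rename split-first (maybe′ [ μ ∘ suc , ρ ]′ (μ zero)) _ (split-first-env μ ρ)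

  no-variables : Fin 0 ⊎ A → A
  no-variables (inj₂ a) = a

  ⊨*-no-variables : ∀ (μ : Fin 0 → ℤ) (ρ : A → ℤ) {C} →
    ρ ⊨* rename no-variables C ⇔ [ μ , ρ ]′ ⊨* C
  ⊨*-no-variables μ ρ = ⊨*-rename no-variables ρ [ μ , ρ ]′ λ { (inj₂ a) → refl }

  project : ∀ n → Conj (Fin n ⊎ A) → DNF A
  project zero    C = rename no-variables C ∷ []
  project (suc n) C = concatMap (project n) (eliminate (rename split-first C))

  project-sound : ∀ n C (ρ : A → ℤ) → Any (ρ ⊨*_) (project n C) → ∃ λ μ → [ μ , ρ ]′ ⊨* C
  project-sound zero    C ρ (here p) = (λ ()) , to (⊨*-no-variables (λ ()) ρ) p
  project-sound (suc n) C ρ p =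
    let D , D∈ , p′ = find (Any.concatMap⁻ (project n) p)
        μ , q       = project-sound n D ρ p′
        z , r       = eliminate-sound [ μ , ρ ]′ (rename split-first C) (lose D∈ q)
    in z Vector.∷ μ , to (⊨*-split-first (z Vector.∷ μ) ρ) r

  project-complete : ∀ n C (ρ : A → ℤ) μ → [ μ , ρ ]′ ⊨* C → Any (ρ ⊨*_) (project n C)
  project-complete zero    C ρ μ p = here (from (⊨*-no-variables μ ρ) p)
  project-complete (suc n) C ρ μ p = Any.concatMap⁺ (project n)
    (Any.map (project-complete n _ ρ (μ ∘ suc))
      (eliminate-complete [ μ ∘ suc , ρ ]′ (μ zero) (rename split-first C)
        (from (⊨*-split-first μ ρ) p)))

  project-positive : ∀ n C → Positive C → All Positive (project n C)
  project-positive zero    C p = All.map⁺ p ∷ []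
  project-positive (suc n) C p = All.concat⁺ (All.map⁺
    (All.map (project-positive n _) (eliminate-positive (rename split-first C) (All.map⁺ p))))

-- Subsumption between positive constraints.

-- The strongest bound of a positive conjunction on each difference x - y, with 0 for "none"
-- and suc k for the bound k; a pointwise greater matrix of such codes is a stronger constraint.
module Subsumption {A : Set} (_≟_ : DecidableEquality A)
                   (terms : List A) (complete : ∀ a → a ∈ terms) where

  _≟²_ : DecidableEquality (A × A)
  _≟²_ = Product.≡-dec _≟_ _≟_

  code : A × A → Conj A → ℕ
  code p []      = 0
  code p (c ∷ C) with (lhs c , rhs c) ≟² p
  ... | yes _ = suc ∣ bound c ∣ ℕ.⊔ code p C
  ... | no  _ = code p C

  bound<code : ∀ {c C} → c ∈ C → ∣ bound c ∣ ℕ.< code (lhs c , rhs c) C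
  bound<code {c} {d ∷ C} c∈ with (lhs d , rhs d) ≟² (lhs c , rhs c) | c∈
  ... | yes _  | here refl = ℕ.m≤m⊔n _ (code _ C)
  ... | no p≢p | here refl = ⊥-elim (p≢p refl)
  ... | yes _  | there c∈C = ℕ.m≤n⇒m≤o⊔n _ (bound<code c∈C)
  ... | no _   | there c∈C = bound<code c∈C

  code-sound : ∀ ρ C {x y n} → Positive C → ρ ⊨* C → n ℕ.< code (x , y) C → + n ≤ ρ x - ρ y
  code-sound ρ (c ∷ C) {x} {y} {n} (0≤k ∷ pos) (h ∷ hs) n< with (lhs c , rhs c) ≟² (x , y)
  ... | no  _    = code-sound ρ C pos hs n<
  ... | yes refl with ℕ.⊔-sel (suc ∣ bound c ∣) (code (x , y) C)
  ... | inj₂ eq = code-sound ρ C pos hs (subst (n ℕ.<_) eq n<)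
  ... | inj₁ eq = ℤ.≤-trans (+≤+ (ℕ.s≤s⁻¹ (subst (n ℕ.<_) eq n<)))
                            (ℤ.≤-trans (ℤ.≤-reflexive (ℤ.0≤i⇒+∣i∣≡i 0≤k)) h)

  pairs : List (A × A)
  pairs = cartesianProduct terms terms

  _≼_ : Conj A → Conj A → Set
  C ≼ D = All (λ p → code p C ℕ.≤ code p D) pairs

  _≼?_ : ∀ C D → Dec (C ≼ D)
  C ≼? D = All.all? (λ p → code p C ℕ.≤? code p D) pairs

  ≼-refl : ∀ {C} → C ≼ C
  ≼-refl = All.universal (λ _ → ℕ.≤-refl) pairs

  ≼-almostFull : AlmostFull _≼_
  ≼-almostFull = AF-All code pairs

  -- A clause of `C` has its bound strictly below the code of its pair in `C`, hence in `D`, so some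
  -- clause of `D` on that pair is at least as strong. Positivity lets the absolute value stand for
  -- the bound.
  ≼-sound : ∀ ρ {C D} → Positive C → Positive D → C ≼ D → ρ ⊨* D → ρ ⊨* C
  ≼-sound ρ {C} {D} C≥0 D≥0 C≼D ρ⊨D = All.tabulate λ {c} c∈ →
    subst (_≤ ρ (lhs c) - ρ (rhs c)) (ℤ.0≤i⇒+∣i∣≡i (All.lookup C≥0 c∈))
      (code-sound ρ D D≥0 ρ⊨D (ℕ.<-≤-trans (bound<code c∈)
        (All.lookup C≼D (∈-cartesianProduct⁺ (complete (lhs c)) (complete (rhs c))))))

-- Composition and transitive closure of positive constraints.

module Constraints {nV nC : ℕ} (cs : Fin nC → ℤ) where

  -- Terms of a gap clause over one valuation, and over a pair (next , current) of valuations.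
  Tm Tm₂ : Set
  Tm  = Fin nV ⊎ Fin nC
  Tm₂ = Fin nV ⊎ Tm

  env : Val nV → Tm → ℤ
  env ν = [ ν , cs ]′

  env₂ : Val nV → Val nV → Tm₂ → ℤ
  env₂ ν ν′ = [ ν′ , env ν ]′

  _≟_ : DecidableEquality Tm₂
  _≟_ = Sum.≡-dec Fin._≟_ (Sum.≡-dec Fin._≟_ Fin._≟_)

  terms : List Tm₂
  terms = map inj₁ (allFin nV) ++ map inj₂ (map inj₁ (allFin nV) ++ map inj₂ (allFin nC))

  terms-complete : ∀ t → t ∈ terms
  terms-complete (inj₁ x)        = ∈-++⁺ˡ (∈-map⁺ inj₁ (∈-allFin x))
  terms-complete (inj₂ (inj₁ x)) =
    ∈-++⁺ʳ (map inj₁ (allFin nV)) (∈-map⁺ inj₂ (∈-++⁺ˡ (∈-map⁺ inj₁ (∈-allFin x))))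
  terms-complete (inj₂ (inj₂ c)) =
    ∈-++⁺ʳ (map inj₁ (allFin nV))
      (∈-map⁺ inj₂ (∈-++⁺ʳ (map inj₁ (allFin nV)) (∈-map⁺ inj₂ (∈-allFin c))))

  open Subsumption _≟_ terms terms-complete

  -- The outer left summand is the intermediate valuation, which `project` eliminates: it is the
  -- next valuation of the first step and the current one of the second.
  first second : Tm₂ → Fin nV ⊎ Tm₂
  first  = [ inj₁ , inj₂ ∘ inj₂ ]′
  second = [ inj₂ ∘ inj₁ , [ inj₁ , inj₂ ∘ inj₂ ∘ inj₂ ]′ ]′

  compose : Conj Tm₂ → Conj Tm₂ → DNF Tm₂
  compose C D = project nV (rename first C ++ rename second D)

  ⊨*-first : ∀ ν μ ν′ {C} → [ μ , env₂ ν ν′ ]′ ⊨* rename first C ⇔ env₂ ν μ ⊨* C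
  ⊨*-first ν μ ν′ = ⊨*-rename first [ μ , env₂ ν ν′ ]′ (env₂ ν μ)
    λ { (inj₁ x) → refl ; (inj₂ t) → refl }

  ⊨*-second : ∀ ν μ ν′ {D} → [ μ , env₂ ν ν′ ]′ ⊨* rename second D ⇔ env₂ μ ν′ ⊨* D
  ⊨*-second ν μ ν′ = ⊨*-rename second [ μ , env₂ ν ν′ ]′ (env₂ μ ν′)
    λ { (inj₁ x) → refl ; (inj₂ (inj₁ x)) → refl ; (inj₂ (inj₂ c)) → refl }

  compose-sound : ∀ C D ν ν′ → Any (env₂ ν ν′ ⊨*_) (compose C D) →
                  ∃ λ μ → env₂ ν μ ⊨* C × env₂ μ ν′ ⊨* D
  compose-sound C D ν ν′ p =
    let μ , q = project-sound nV (rename first C ++ rename second D) (env₂ ν ν′) p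
        l , r = All.++⁻ (rename first C) q
    in μ , to (⊨*-first ν μ ν′) l , to (⊨*-second ν μ ν′) r

  compose-complete : ∀ C D ν μ ν′ → env₂ ν μ ⊨* C → env₂ μ ν′ ⊨* D →
                     Any (env₂ ν ν′ ⊨*_) (compose C D)
  compose-complete C D ν μ ν′ p q =
    project-complete nV (rename first C ++ rename second D) (env₂ ν ν′) μ
      (All.++⁺ (from (⊨*-first ν μ ν′) p) (from (⊨*-second ν μ ν′) q))

  compose-positive : ∀ C D → Positive C → Positive D → All Positive (compose C D)
  compose-positive C D p q = project-positive nV (rename first C ++ rename second D)
    (All.++⁺ (All.map⁺ p) (All.map⁺ q))

  record PosDefinable (R : Val nV → Val nV → Set) : Set where
    field
      disjuncts : DNF Tm₂
      positive  : All Positive disjuncts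
      correct   : ∀ ν ν′ → Any (env₂ ν ν′ ⊨*_) disjuncts ⇔ R ν ν′

  -- Saturate under composition with R; since subsumption is almost full, this terminates.
  transClosure-definable : ∀ {R} → PosDefinable R → PosDefinable (TransClosure R)
  transClosure-definable {R} def = record
    { disjuncts = elements
    ; positive  = All.map proj₁ invariant
    ; correct   = λ ν ν′ → mk⇔
        (λ p → let _ , D∈ , q = find p in proj₂ (All.lookup invariant D∈) ν ν′ q)
        (complete ν ν′)
    }
    where
    open PosDefinable def
    open Saturation _≼_ _≼?_ (λ {C} → ≼-refl {C})

    next : Conj Tm₂ → DNF Tm₂
    next D = concatMap (λ C → compose C D) disjuncts

    Sound : Conj Tm₂ → Set
    Sound D = Positive D × (∀ ν ν′ → env₂ ν ν′ ⊨* D → TransClosure R ν ν′)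

    next-sound : ∀ {D} → Sound D → All Sound (next D)
    next-sound {D} (D≥0 , D⇒R⁺) = All.concat⁺ (All.map⁺ (All.tabulate λ {C} C∈ →
      All.tabulate λ {E} E∈ →
        All.lookup (compose-positive C D (All.lookup positive C∈) D≥0) E∈ ,
        λ ν ν′ p → let μ , p₁ , p₂ = compose-sound C D ν ν′ (lose E∈ p) in
          to (correct ν μ) (lose C∈ p₁) ∷ D⇒R⁺ μ ν′ p₂))

    disjuncts-sound : All Sound disjuncts
    disjuncts-sound = All.tabulate λ C∈ →
      All.lookup positive C∈ , λ ν ν′ p → [ to (correct ν ν′) (lose C∈ p) ]

    open Saturated (saturate next next-sound disjuncts (AF⇒Bar ≼-almostFull) disjuncts-sound)

    covered : ∀ {D} ν ν′ → Positive D → Covers elements D → env₂ ν ν′ ⊨* D →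
              Any (env₂ ν ν′ ⊨*_) elements
    covered ν ν′ D≥0 cov p =
      let _ , C∈ , C≼D = find cov
      in lose C∈ (≼-sound (env₂ ν ν′) (proj₁ (All.lookup invariant C∈)) D≥0 C≼D p)

    complete : ∀ ν ν′ → TransClosure R ν ν′ → Any (env₂ ν ν′ ⊨*_) elements
    complete ν ν′ [ r ] =
      let _ , C∈ , p = find (from (correct ν ν′) r)
      in covered ν ν′ (All.lookup positive C∈) (initial C∈) p
    -- The tail satisfies a stored `D`, so some disjunct `E` of the composite of `C` and `D` holds
    -- and is a successor of `D`. The element covering `E` is weaker, so it holds too.
    complete ν ν′ (_∷_ {y = μ} r rs) =
      let C , C∈ , p = find (from (correct ν μ) r)
          D , D∈ , q = find (complete μ ν′ rs)
          E , E∈ , s = find (compose-complete C D ν μ ν′ p q)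
          E≥0        = compose-positive C D (All.lookup positive C∈)
                         (proj₁ (All.lookup invariant D∈))
      in covered ν ν′ (All.lookup E≥0 E∈)
           (closed D∈ (∈-concatMap⁺ (λ C → compose C D) (lose C∈ E∈))) s

-- Boolean operations on disjunctive normal forms.

negate : ∀ {A} → Clause A → Clause A
negate (clause x y k) = clause y x (1ℤ - k)

module _ {A : Set} (ρ : A → ℤ) where

  ⊨-dec : ∀ c → Dec (ρ ⊨ c)
  ⊨-dec c = bound c ≤? _

  1-‿-‿ : ∀ k x y → x - y - (1ℤ - k) ≡ k - (1ℤ + (y - x))
  1-‿-‿ = solve-∀

  -- Over the integers `x - y < k` means `x - y ≤ k - 1`, that is `y - x ≥ 1 - k`.
  ⊨-negate : ∀ c → ρ ⊨ negate c ⇔ (¬ ρ ⊨ c)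
  ⊨-negate (clause x y k) = mk⇔
    (λ h k≤ → ℤ.<⇒≱ (ℤ.suc[i]≤j⇒i<j (Bounds.≤-shift (1-‿-‿ k (ρ y) (ρ x)) h)) k≤)
    (λ k≰ → Bounds.≤-shift (sym (1-‿-‿ k (ρ y) (ρ x))) (ℤ.i<j⇒suc[i]≤j (ℤ.≰⇒> k≰)))

  ⊨*-negate : ∀ C → Any (ρ ⊨*_) (map (λ c → negate c ∷ []) C) ⇔ (¬ ρ ⊨* C)
  ⊨*-negate C = mk⇔
    (λ p q → let c , c∈ , h = find (Any.map⁻ p) in to (⊨-negate c) (All.head h) (All.lookup q c∈))
    (λ ¬p → Any.map⁺ (Any.map (λ {c} ¬h → from (⊨-negate c) ¬h ∷ []) (All.¬All⇒Any¬ ⊨-dec C ¬p)))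

_∧ᴰ_ : ∀ {A} → DNF A → DNF A → DNF A
_∧ᴰ_ = cartesianProductWith _++_

¬ᴰ_ : ∀ {A} → DNF A → DNF A
¬ᴰ_ = foldr (λ C → map (λ c → negate c ∷ []) C ∧ᴰ_) ([] ∷ [])

module _ {A : Set} (ρ : A → ℤ) where

  ∧ᴰ-correct : ∀ D E → Any (ρ ⊨*_) (D ∧ᴰ E) ⇔ (Any (ρ ⊨*_) D × Any (ρ ⊨*_) E)
  ∧ᴰ-correct D E = mk⇔ (Any.cartesianProductWith⁻ _++_ (All.++⁻ _) D E)
                       (uncurry (Any.cartesianProductWith⁺ _++_ All.++⁺))

  ¬ᴰ-correct : ∀ D → Any (ρ ⊨*_) (¬ᴰ D) ⇔ (¬ Any (ρ ⊨*_) D)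
  ¬ᴰ-correct []      = mk⇔ (λ _ ()) (λ _ → here [])
  ¬ᴰ-correct (C ∷ D) = mk⇔
    (λ p → let ¬C , ¬D = to (∧ᴰ-correct _ (¬ᴰ D)) p in
      λ { (here q) → to (⊨*-negate ρ C) ¬C q ; (there q) → to (¬ᴰ-correct D) ¬D q })
    (λ ¬p → from (∧ᴰ-correct _ (¬ᴰ D))
      (from (⊨*-negate ρ C) (¬p ∘ here) , from (¬ᴰ-correct D) (¬p ∘ there)))

-- Gap definable sets and their preimages.

module GapDefinable {nV nC : ℕ} (cs : Fin nC → ℤ) where
  open Constraints {nV} cs

  record Definable (P : Val nV → Set) : Set where
    constructor definable
    field
      dnf     : DNF Tm
      correct : ∀ ν → Any (env ν ⊨*_) dnf ⇔ P ν

  private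
    variable
      P Q : Val nV → Set

  -- Decidability makes definable predicates stable under double negation, so that `definable-∀` and
  -- `definable-□` can be read off complements of existential statements.
  decide : Definable P → Decidable P
  decide (definable D c) ν =
    map′ (to (c ν)) (from (c ν)) (Any.any? (All.all? (⊨-dec (env ν))) D)

  definable-⇔ : (∀ ν → P ν ⇔ Q ν) → Definable P → Definable Q
  definable-⇔ P⇔Q (definable D c) = definable D λ ν →
    mk⇔ (to (P⇔Q ν) ∘ to (c ν)) (from (c ν) ∘ from (P⇔Q ν))

  definable-const : ∀ {A : Set} → Dec A → Definable (λ _ → A)
  definable-const (yes a) = definable ([] ∷ []) λ _ → mk⇔ (λ _ → a) (λ _ → here [])
  definable-const (no ¬a) = definable [] λ _ → mk⇔ (λ ()) (⊥-elim ∘ ¬a)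

  definable-∪ : Definable P → Definable Q → Definable (λ ν → P ν ⊎ Q ν)
  definable-∪ (definable D c) (definable E d) = definable (D ++ E) λ ν → mk⇔
    (Sum.map (to (c ν)) (to (d ν)) ∘ Any.++⁻ D)
    [ Any.++⁺ˡ ∘ from (c ν) , Any.++⁺ʳ D ∘ from (d ν) ]′

  definable-∩ : Definable P → Definable Q → Definable (λ ν → P ν × Q ν)
  definable-∩ (definable D c) (definable E d) = definable (D ∧ᴰ E) λ ν → mk⇔
    (λ p → let q , r = to (∧ᴰ-correct (env ν) D E) p in to (c ν) q , to (d ν) r)
    (λ (p , q) → from (∧ᴰ-correct (env ν) D E) (from (c ν) p , from (d ν) q))

  definable-∁ : Definable P → Definable (λ ν → ¬ P ν)
  definable-∁ (definable D c) = definable (¬ᴰ D) λ ν → mk⇔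
    (λ p → to (¬ᴰ-correct (env ν) D) p ∘ from (c ν))
    (λ ¬p → from (¬ᴰ-correct (env ν) D) (¬p ∘ to (c ν)))

  definable-→ : ∀ {A : Set} → Dec A → Definable P → Definable (λ ν → A → P ν)
  definable-→ (yes a) = definable-⇔ λ _ → mk⇔ (λ p _ → p) (λ f → f a)
  definable-→ (no ¬a) _ = definable-⇔ {P = λ _ → ⊤}
    (λ _ → mk⇔ (λ _ a → ⊥-elim (¬a a)) _) (definable-const (yes _))

  definable-∃ : ∀ n {P : Fin n → Val nV → Set} → (∀ i → Definable (P i)) →
                Definable (λ ν → ∃ λ i → P i ν)
  definable-∃ zero    d = definable-⇔ (λ _ → mk⇔ ⊥-elim λ ()) (definable-const (no id))
  definable-∃ (suc n) {P} d = definable-⇔ {P = λ ν → P zero ν ⊎ ∃ λ i → P (suc i) ν}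
    (λ _ → mk⇔ [ zero ,_ , (λ (i , p) → suc i , p) ]′
               λ { (zero , p) → inj₁ p ; (suc i , p) → inj₂ (i , p) })
    (definable-∪ (d zero) (definable-∃ n (d ∘ suc)))

  definable-∀ : ∀ n {P : Fin n → Val nV → Set} → (∀ i → Definable (P i)) →
                Definable (λ ν → ∀ i → P i ν)
  definable-∀ n d = definable-⇔
    (λ ν → mk⇔ (λ ¬∃ i → decidable-stable (decide (d i) ν) λ ¬p → ¬∃ (i , ¬p))
               (λ all (i , ¬p) → ¬p (all i)))
    (definable-∁ (definable-∃ n (definable-∁ ∘ d)))

  term : Tm → Term nV nC
  term = [ var , cst ]′

  formulaᶜ : Conj Tm → GapFormula nV nC
  formulaᶜ = foldr (λ c → gap (term (lhs c)) (term (rhs c)) (bound c) ∧ᶠ_) tt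

  formula : DNF Tm → GapFormula nV nC
  formula = foldr (λ C → formulaᶜ C ∨ᶠ_) (¬ᶠ tt)

  ⟦term⟧ : ∀ ν t → ⟦ term t ⟧ₜ cs ν ≡ env ν t
  ⟦term⟧ ν (inj₁ x) = refl
  ⟦term⟧ ν (inj₂ c) = refl

  formulaᶜ-correct : ∀ ν C → Sat cs ν (formulaᶜ C) ⇔ env ν ⊨* C
  formulaᶜ-correct ν []      = mk⇔ (λ _ → []) _
  formulaᶜ-correct ν (c ∷ C) = mk⇔
    (λ (p , q) → subst (bound c ≤_) eq p ∷ to (formulaᶜ-correct ν C) q)
    (λ { (p ∷ q) → subst (bound c ≤_) (sym eq) p , from (formulaᶜ-correct ν C) q })
    where eq = cong₂ _-_ (⟦term⟧ ν (lhs c)) (⟦term⟧ ν (rhs c))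

  formula-correct : ∀ ν D → Sat cs ν (formula D) ⇔ Any (env ν ⊨*_) D
  formula-correct ν []      = mk⇔ (λ ¬tt → ⊥-elim (¬tt _)) λ ()
  formula-correct ν (C ∷ D) = mk⇔
    [ here ∘ to (formulaᶜ-correct ν C) , there ∘ to (formula-correct ν D) ]′
    λ { (here p)  → inj₁ (from (formulaᶜ-correct ν C) p)
      ; (there p) → inj₂ (from (formula-correct ν D) p) }

  Pre : (Val nV → Val nV → Set) → (Val nV → Set) → Val nV → Set
  Pre R P ν = ∃ λ ν′ → R ν ν′ × P ν′

  PreDefinable : (Val nV → Val nV → Set) → Set₁
  PreDefinable R = ∀ {P} → Definable P → Definable (Pre R P)

  PosDefinable⇒PreDefinable : ∀ {R} → PosDefinable R → PreDefinable R
  PosDefinable⇒PreDefinable def (definable D c) = definable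
    (concatMap (λ C → concatMap (λ E → project nV (C ++ rename at-next E)) D) disjuncts) λ ν → mk⇔
      (λ p → let C , C∈ , p′ = find (Any.concatMap⁻ _ p)
                 E , E∈ , q  = find (Any.concatMap⁻ (λ E → project nV (C ++ rename at-next E)) p′)
                 ν′ , r      = project-sound nV (C ++ rename at-next E) (env ν) q
                 r₁ , r₂     = All.++⁻ C r
             in ν′ , to (posCorrect ν ν′) (lose C∈ r₁) ,
                to (c ν′) (lose E∈ (to (⊨*-at-next ν ν′) r₂)))
      (λ (ν′ , r , p) →
        Any.concatMap⁺ _ (Any.map (λ {C} hC →
          Any.concatMap⁺ _ (Any.map (λ {E} hE →
              project-complete nV (C ++ rename at-next E) (env ν) ν′
                (All.++⁺ hC (from (⊨*-at-next ν ν′) hE)))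
            (from (c ν′) p)))
          (from (posCorrect ν ν′) r)))
    where
    open PosDefinable def renaming (correct to posCorrect)

    at-next : Tm → Tm₂
    at-next = [ inj₁ , inj₂ ∘ inj₂ ]′

    ⊨*-at-next : ∀ ν ν′ {E} → env₂ ν ν′ ⊨* rename at-next E ⇔ env ν′ ⊨* E
    ⊨*-at-next ν ν′ = ⊨*-rename at-next (env₂ ν ν′) (env ν′)
      λ { (inj₁ x) → refl ; (inj₂ c) → refl }

  definable-□ : ∀ {R} → PreDefinable R → Definable P → Definable (λ ν → ∀ ν′ → R ν ν′ → P ν′)
  definable-□ pre d = definable-⇔
    (λ ν → mk⇔ (λ ¬∃ ν′ r → decidable-stable (decide d ν′) λ ¬p → ¬∃ (ν′ , r , ¬p))
               (λ all (ν′ , r , ¬p) → ¬p (all ν′ r)))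
    (definable-∁ (pre (definable-∁ d)))

  -- A path is empty or belongs to the transitive closure, so the preimage of `P` is the union of
  -- `P` with a preimage under a positively definable relation.
  star-preDefinable : ∀ {R} → PosDefinable R → PreDefinable (Star R)
  star-preDefinable {R} def {P} d = definable-⇔
    (λ _ → mk⇔ [ (λ p → _ , ε , p) , map₂ (map₁ ⁺⇒*) ]′ λ (_ , rs , p) → split rs p)
    (definable-∪ d (PosDefinable⇒PreDefinable (transClosure-definable def) d))
    where
    ⁺⇒* : ∀ {ν ν′} → TransClosure R ν ν′ → Star R ν ν′
    ⁺⇒* [ r ]    = r ◅ ε
    ⁺⇒* (r ∷ rs) = r ◅ ⁺⇒* rs

    -- ε cannot be a disjunct of a constraint: without extensionality, pointwise equal valuations
    -- need not be equal.
    split : ∀ {ν ν′} → Star R ν ν′ → P ν′ → P ν ⊎ Pre (TransClosure R) P ν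
    split ε        p = inj₁ p
    split (r ◅ rs) p =
      inj₂ ([ (λ q → _ , [ r ] , q) , (λ (_ , r⁺ , q) → _ , r ∷ r⁺ , q) ]′ (split rs p))

-- Weak bisimulation and its approximants.

open LTS

AnyStep : ∀ {nA} (L : LTS 0ℓ nA) → State L → State L → Set
AnyStep L x y = ∃ λ a → step L a x y

-- Abstracts a summand of a disjoint union: no step leaves the image, so weak steps transfer in both
-- directions.
record Embedding {nA} (L M : LTS 0ℓ nA) : Set where
  field
    ⟪_⟫      : State L → State M
    preserve : ∀ {a x y} → step L a x y → step M a ⟪ x ⟫ ⟪ y ⟫
    reflect  : ∀ {a x u} → step M a ⟪ x ⟫ u → ∃ λ y → u ≡ ⟪ y ⟫ × step L a x y

module _ {nA : ℕ} {L M : LTS 0ℓ nA} where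

  embed₁ : Embedding L (L ⊎ᴸ M)
  embed₁ = record
    { ⟪_⟫ = inj₁ ; preserve = id
    ; reflect = λ { {u = inj₁ y} s → y , refl , s } }

  embed₂ : Embedding M (L ⊎ᴸ M)
  embed₂ = record
    { ⟪_⟫ = inj₂ ; preserve = id
    ; reflect = λ { {u = inj₂ y} s → y , refl , s } }

module WeakBisimulation {nA : ℕ} (τ : Fin nA) where

  Weakly : (L : LTS 0ℓ nA) → Fin nA → State L → State L → Set
  Weakly L = Weak.WeakStep τ L

  step⇒weakly : ∀ L {a x y} → step L a x y → Weakly L a x y
  step⇒weakly L {a} s with a Fin.≟ τ
  ... | yes refl = s ◅ ε
  ... | no  _    = _ , _ , ε , s , ε

  weakly⇒any* : ∀ L {a x y} → Weakly L a x y → Star (AnyStep L) x y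
  weakly⇒any* L {a} w with a Fin.≟ τ | w
  ... | yes _ | ss                   = gmap id (τ ,_) ss
  ... | no  _ | _ , _ , ss , s , ss′ = gmap id (τ ,_) ss ◅◅ (a , s) ◅ gmap id (τ ,_) ss′

  module _ {L M : LTS 0ℓ nA} (E : Embedding L M) where
    open Embedding E

    preserve* : ∀ {a x y} → Star (step L a) x y → Star (step M a) ⟪ x ⟫ ⟪ y ⟫
    preserve* = gmap ⟪_⟫ preserve

    reflect* : ∀ {a x u} → Star (step M a) ⟪ x ⟫ u → ∃ λ y → u ≡ ⟪ y ⟫ × Star (step L a) x y
    reflect* ε        = _ , refl , ε
    reflect* (s ◅ ss) with reflect s
    ... | _ , refl , s′ with reflect* ss
    ... | y , eq , ss′ = y , eq , s′ ◅ ss′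

    weakly-preserve : ∀ a {x y} → Weakly L a x y → Weakly M a ⟪ x ⟫ ⟪ y ⟫
    weakly-preserve a w with a Fin.≟ τ | w
    ... | yes _ | ss = preserve* ss
    ... | no  _ | _ , _ , ss , s , ss′ = _ , _ , preserve* ss , preserve s , preserve* ss′

    weakly-reflect : ∀ a {x u} → Weakly M a ⟪ x ⟫ u → ∃ λ y → u ≡ ⟪ y ⟫ × Weakly L a x y
    weakly-reflect a w with a Fin.≟ τ | w
    ... | yes _ | ss = reflect* ss
    ... | no  _ | _ , _ , ss , s , ss′ with reflect* ss
    ... | _ , refl , rs with reflect s
    ... | _ , refl , r with reflect* ss′
    ... | y , eq , rs′ = y , eq , _ , _ , rs , r , rs′

  module _ (L M : LTS 0ℓ nA) where

    -- The `n`-round weak bisimulation game, stated between two systems so that the finite one can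
    -- also be compared with itself.
    Approx : ℕ → State L → State M → Set
    Approx zero    x y = ⊤
    Approx (suc n) x y =
        (∀ a x′ → Weakly L a x x′ → Σ (State M) λ y′ → Weakly M a y y′ × Approx n x′ y′)
      × (∀ a y′ → Weakly M a y y′ → Σ (State L) λ x′ → Weakly L a x x′ × Approx n x′ y′)

    approx-pred : ∀ n {x y} → Approx (suc n) x y → Approx n x y
    approx-pred zero    _       = _
    approx-pred (suc n) (f , g) =
      (λ a x′ w → map₂ (map₂ (approx-pred n)) (f a x′ w)) ,
      (λ a y′ w → map₂ (map₂ (approx-pred n)) (g a y′ w))

  approx-sym : ∀ L M n {x y} → Approx L M n x y → Approx M L n y x
  approx-sym L M zero    _       = _
  approx-sym L M (suc n) (f , g) =
    (λ a x′ w → map₂ (map₂ (approx-sym L M n)) (g a x′ w)) ,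
    (λ a y′ w → map₂ (map₂ (approx-sym L M n)) (f a y′ w))

  approx-trans : ∀ L M N n {x y z} → Approx L M n x y → Approx M N n y z → Approx L N n x z
  approx-trans L M N zero    _       _         = _
  approx-trans L M N (suc n) (f , g) (f′ , g′) =
    (λ a x′ w → let y′ , w′ , p = f a x′ w ; z′ , w″ , q = f′ a y′ w′ in
                z′ , w″ , approx-trans L M N n p q) ,
    (λ a z′ w → let y′ , w′ , p = g′ a z′ w ; x′ , w″ , q = g a y′ w′ in
                x′ , w″ , approx-trans L M N n q p)

  module _ (L M : LTS 0ℓ nA) where
    open Weak τ (L ⊎ᴸ M) using (IsWeakBisim; _≈_)

    bisimilar-forth : ∀ {x y a x′} → inj₁ x ≈ inj₂ y → Weakly L a x x′ →
                      ∃ λ y′ → Weakly M a y y′ × inj₁ x′ ≈ inj₂ y′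
    bisimilar-forth (R , bisim , r) w
      with u , w′ , r′ ← proj₁ (bisim _ _ r) _ _ (weakly-preserve embed₁ _ w)
      with y′ , refl , w″ ← weakly-reflect embed₂ _ w′ = y′ , w″ , R , bisim , r′

    bisimilar-back : ∀ {x y a y′} → inj₁ x ≈ inj₂ y → Weakly M a y y′ →
                     ∃ λ x′ → Weakly L a x x′ × inj₁ x′ ≈ inj₂ y′
    bisimilar-back (R , bisim , r) w
      with u , w′ , r′ ← proj₂ (bisim _ _ r) _ _ (weakly-preserve embed₂ _ w)
      with x′ , refl , w″ ← weakly-reflect embed₁ _ w′ = x′ , w″ , R , bisim , r′

    bisimilar⇒approx : ∀ n {x y} → inj₁ x ≈ inj₂ y → Approx L M n x y
    bisimilar⇒approx zero    _ = _
    bisimilar⇒approx (suc n) b =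
      (λ a x′ w → map₂ (map₂ (bisimilar⇒approx n)) (bisimilar-forth b w)) ,
      (λ a y′ w → map₂ (map₂ (bisimilar⇒approx n)) (bisimilar-back b w))

    -- Each strong step is also a weak step and is therefore answered. This makes `Matched` a
    -- necessary condition for bisimilarity.
    bisimilar-reachable : ∀ {x y x′} → inj₁ x ≈ inj₂ y → Star (AnyStep L) x x′ →
                          ∃ λ y′ → inj₁ x′ ≈ inj₂ y′
    bisimilar-reachable b ε              = _ , b
    bisimilar-reachable b ((_ , s) ◅ ss) =
      let _ , _ , b′ = bisimilar-forth b (step⇒weakly L s) in bisimilar-reachable b′ ss

    Matched : ℕ → State L → Set
    Matched n x = ∀ x′ → Star (AnyStep L) x x′ → ∃ λ y → Approx L M n x′ y

    -- If ~ₖ and ~ₖ₊₁ agree on M, then a reachable x with x ~ₖ s and x ~ₖ₊₁ t has s ~ₖ₊₁ t, and so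
    -- x ~ₖ₊₁ s: the relation ~ₖ between reachable states of L and states of M is a weak bisimulation.
    bisimilar⇔ : ∀ k → (∀ s t → Approx M M k s t → Approx M M (suc k) s t) → ∀ x s →
                 (Approx L M k x s × Matched (suc k) x) ⇔ inj₁ x ≈ inj₂ s
    bisimilar⇔ k stable x s = mk⇔
      (λ p → R , R-bisim , p)
      (λ b → bisimilar⇒approx k b ,
        λ x′ ss → map₂ (bisimilar⇒approx (suc k)) (bisimilar-reachable b ss))
      where
      R : State (L ⊎ᴸ M) → State (L ⊎ᴸ M) → Set
      R (inj₁ x) (inj₂ s) = Approx L M k x s × Matched (suc k) x
      R _        _        = ⊥

      improve : ∀ {x s} → Approx L M k x s → Matched (suc k) x → Approx L M (suc k) x s
      improve {x} {s} x~s matched = let t , x~t = matched x ε in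
        approx-trans L M M (suc k) x~t
          (stable t s (approx-trans M L M k (approx-sym L M k (approx-pred L M k x~t)) x~s))

      weakly-matched : ∀ {a x x′} → Matched (suc k) x → Weakly L a x x′ → Matched (suc k) x′
      weakly-matched matched w x″ ss = matched x″ (weakly⇒any* L w ◅◅ ss)

      R-bisim : IsWeakBisim R
      R-bisim (inj₁ x) (inj₂ s) (x~s , matched) = forth , back
        where
        x~⁺s = improve x~s matched

        forth : ∀ a u → Weakly (L ⊎ᴸ M) a (inj₁ x) u →
                ∃ λ v → Weakly (L ⊎ᴸ M) a (inj₂ s) v × R u v
        forth a u w with x′ , refl , w′ ← weakly-reflect embed₁ a w =
          let s′ , w″ , p = proj₁ x~⁺s a x′ w′
          in inj₂ s′ , weakly-preserve embed₂ a w″ , p , weakly-matched matched w′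

        back : ∀ a v → Weakly (L ⊎ᴸ M) a (inj₂ s) v →
               ∃ λ u → Weakly (L ⊎ᴸ M) a (inj₁ x) u × R u v
        back a v w with s′ , refl , w′ ← weakly-reflect embed₂ a w =
          let x′ , w″ , p = proj₂ x~⁺s a s′ w′
          in inj₁ x′ , weakly-preserve embed₁ a w″ , p , weakly-matched matched w″

-- Stabilisation and decidability over finite state sets.

stabilises : {X : Set} (P : ℕ → X → Set) → (∀ n → Decidable (P n)) →
             (∀ n {x} → P (suc n) x → P n x) → ∀ xs → (∀ x → x ∈ xs) →
             ∃ λ k → ∀ x → P k x → P (suc k) x
stabilises {X} P P? P-anti xs complete = go 0 xs (<-wellFounded _) λ {x} _ → complete x
  where
  go : ∀ n ys → Acc ℕ._<_ (length ys) → (∀ {x} → P n x → x ∈ ys) →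
       ∃ λ k → ∀ x → P k x → P (suc k) x
  -- `ys` contains all points of `P n`. If some entry fails `P (suc n)`, filtering shortens `ys`
  -- strictly, which can happen only finitely often.
  go n ys (acc rec) Pₙ⊆ys with All.all? (P? (suc n)) ys
  ... | yes all = n , λ x p → All.lookup all (Pₙ⊆ys p)
  ... | no ¬all = go (suc n) (filter (P? (suc n)) ys)
    (rec (filter-notAll (P? (suc n)) ys (All.¬All⇒Any¬ (P? (suc n)) ys ¬all)))
    (λ p → ∈-filter⁺ (P? (suc n)) (Pₙ⊆ys (P-anti n p)) p)

module FiniteReachability {m : ℕ} {R : Fin m → Fin m → Set} (R? : ∀ s t → Dec (R s t)) where
  open Saturation (_≡_ {A = Fin m}) Fin._≟_ refl

  other? : ∀ x → Decidable {A = Fin m} (λ y → ¬ x ≡ y)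
  other? x y = ¬? (x Fin.≟ y)

  -- `xs` lists candidates for extension: an uncovered `x` must occur in it and is then filtered
  -- out, so the length decreases.
  bar-Fin : ∀ {D} xs → Acc ℕ._<_ (length xs) → (∀ x → Covers D x ⊎ x ∈ xs) → Bar D
  bar-Fin {D} xs (acc rec) rest = bar λ x ¬x →
    let x∈xs = [ ⊥-elim ∘ ¬x , id ]′ (rest x)
    in bar-Fin (filter (other? x) xs)
         (rec (filter-notAll (other? x) xs (Any.map (λ x≡y x≢y → x≢y x≡y) x∈xs)))
         (rest′ x)
    where
    rest′ : ∀ x y → Covers (x ∷ D) y ⊎ y ∈ filter (other? x) xs
    rest′ x y with x Fin.≟ y
    ... | yes x≡y = inj₁ (here x≡y)
    ... | no  x≢y = Sum.map there (λ y∈ → ∈-filter⁺ (other? x) y∈ x≢y) (rest y)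

  -- Saturating the singleton list of `s` under successors, with equality as covering, lists exactly
  -- the states reachable from `s`.
  star? : ∀ s t → Dec (Star R s t)
  star? s t = map′
    (λ c → let _ , u∈ , u≡t = find c in subst (Star R s) u≡t (All.lookup invariant u∈))
    (λ ss → reach ss (initial (here refl)))
    (Any.any? (Fin._≟ t) elements)
    where
    next : Fin m → List (Fin m)
    next u = filter (R? u) (allFin m)

    next-reachable : ∀ {u} → Star R s u → All (Star R s) (next u)
    next-reachable {u} su = All.tabulate λ v∈ →
      su ◅◅ proj₂ (∈-filter⁻ (R? u) {xs = allFin m} v∈) ◅ ε

    open Saturated (saturate next next-reachable (s ∷ [])
      (bar-Fin (allFin m) (<-wellFounded _) (inj₂ ∘ ∈-allFin)) (ε ∷ []))

    reach : ∀ {u} → Star R u t → Covers elements u → Covers elements t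
    reach ε        c = c
    reach (r ◅ rs) c with _ , u∈ , refl ← find c =
      reach rs (closed u∈ (∈-filter⁺ (R? _) (∈-allFin _) r))

module FiniteSystem {nA : ℕ} (τ : Fin nA) (T : FinLTS nA) where
  open FinLTS T
  open WeakBisimulation τ

  L : LTS 0ℓ nA
  L = FinLTS→LTS T

  step? : ∀ a s t → Dec (step L a s t)
  step? a s t = trans a s t Bool.≟ true

  open FiniteReachability (step? τ)

  weakly? : ∀ a s t → Dec (Weakly L a s t)
  weakly? a s t with a Fin.≟ τ
  ... | yes _ = star? s t
  ... | no  _ = Fin.any? λ s₁ → Fin.any? λ t₁ → star? s s₁ ×-dec step? a s₁ t₁ ×-dec star? t₁ t

  approx? : ∀ n s t → Dec (Approx L L n s t)
  approx? zero    s t = yes _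
  approx? (suc n) s t =
    (Fin.all? λ a → Fin.all? λ s′ → weakly? a s s′ →-dec
      Fin.any? λ t′ → weakly? a t t′ ×-dec approx? n s′ t′)
    ×-dec
    (Fin.all? λ a → Fin.all? λ t′ → weakly? a t t′ →-dec
      Fin.any? λ s′ → weakly? a s s′ ×-dec approx? n s′ t′)

  approx-stabilises : ∃ λ k → ∀ s t → Approx L L k s t → Approx L L (suc k) s t
  approx-stabilises = map₂ (λ stable s t → stable (s , t))
    (stabilises {X = Fin m × Fin m} (λ n (s , t) → Approx L L n s t)
      (λ n (s , t) → approx? n s t) (λ n → approx-pred L L n)
      (cartesianProduct (allFin m) (allFin m))
      λ (s , t) → ∈-cartesianProduct⁺ (∈-allFin s) (∈-allFin t))

-- Gap definability of the approximants for a gap constraint system.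

module GapSystem {nA : ℕ} (G : GCS nA) where
  open GCS G
  open Constraints {nV} consts
  open GapDefinable {nV} consts

  term₂ : Term₂ nV nC → Tm₂
  term₂ (cur x) = inj₂ (inj₁ x)
  term₂ (nxt x) = inj₁ x
  term₂ (cst c) = inj₂ (inj₂ c)

  ⟦term₂⟧ : ∀ ν ν′ t → ⟦ t ⟧₂ consts ν ν′ ≡ env₂ ν ν′ (term₂ t)
  ⟦term₂⟧ ν ν′ (cur x) = refl
  ⟦term₂⟧ ν ν′ (nxt x) = refl
  ⟦term₂⟧ ν ν′ (cst c) = refl

  conj : PosConstraint nV nC → Conj Tm₂
  conj = map λ { (x − y ≥ k) → clause (term₂ x) (term₂ y) (+ k) }

  conj-correct : ∀ ν ν′ C → env₂ ν ν′ ⊨* conj C ⇔ SatConstraint consts ν ν′ C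
  conj-correct ν ν′ C = mk⇔
    (All.map (λ {c} → subst id (sym (clause-≡ c))) ∘ All.map⁻)
    (All.map⁺ ∘ All.map (λ {c} → subst id (clause-≡ c)))
    where
    clause-≡ : ∀ c → SatClause consts ν ν′ c ≡
                     (env₂ ν ν′ ⊨ (let x − y ≥ k = c in clause (term₂ x) (term₂ y) (+ k)))
    clause-≡ (x − y ≥ k) = cong₂ (λ i j → + k ≤ i - j) (⟦term₂⟧ ν ν′ x) (⟦term₂⟧ ν ν′ y)

  -- The predicate on labels serves both a single action and the union over all actions.
  labelled-definable : {Q : Fin nA → Set} → Decidable Q →
    PosDefinable (λ ν ν′ → Any (λ (C , a) → SatConstraint consts ν ν′ C × Q a) Δλ)
  labelled-definable Q? = record
    { disjuncts = map (conj ∘ proj₁) Δ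
    ; positive  = All.map⁺ (All.universal (λ _ → All.map⁺ (All.universal (λ _ → +≤+ z≤n) _)) Δ)
    ; correct   = λ ν ν′ → mk⇔
        (λ p → let _ , c∈ , h = find (Any.map⁻ {xs = Δ} p)
                   c∈Δλ , q = ∈-filter⁻ (Q? ∘ proj₂) {xs = Δλ} c∈
               in lose c∈Δλ (to (conj-correct ν ν′ _) h , q))
        (λ p → let _ , c∈Δλ , h , q = find p
               in Any.map⁺ (lose (∈-filter⁺ (Q? ∘ proj₂) c∈Δλ q) (from (conj-correct ν ν′ _) h)))
    }
    where
    Δ = filter (Q? ∘ proj₂) Δλ

  step-definable : ∀ a → PosDefinable (step T⟦ G ⟧ a)
  step-definable a = labelled-definable (Fin._≟ a)

  anyStep-definable : PosDefinable (AnyStep T⟦ G ⟧)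
  anyStep-definable = record
    { disjuncts = disjuncts ; positive = positive
    ; correct = λ ν ν′ → mk⇔
        (λ p → let (_ , a) , c∈ , h , _ = find (to (correct ν ν′) p) in a , lose c∈ (h , refl))
        (λ (_ , s) → from (correct ν ν′) (Any.map (map₂ _) s))
    }
    where open PosDefinable (labelled-definable {Q = λ _ → ⊤} (λ _ → yes _))

  module _ (τ : Fin nA) where
    open WeakBisimulation τ

    weakly-preDefinable : ∀ a → PreDefinable (Weakly T⟦ G ⟧ a)
    weakly-preDefinable a {P} d with a Fin.≟ τ
    ... | yes _ = star-preDefinable (step-definable τ) d
    -- `τ*` is handled through its preimages, so the three phases of the weak step become nested
    -- preimages.
    ... | no  _ = definable-⇔ {P = Pre τ* (Pre (step T⟦ G ⟧ a) (Pre τ* P))}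
      (λ _ → mk⇔ (λ (_ , ss , _ , s , _ , ss′ , p) → _ , (_ , _ , ss , s , ss′) , p)
                 (λ (_ , (_ , _ , ss , s , ss′) , p) → _ , ss , _ , s , _ , ss′ , p))
      (τ*-pre (PosDefinable⇒PreDefinable (step-definable a) (τ*-pre d)))
      where
      τ* : Val nV → Val nV → Set
      τ* = Star (step T⟦ G ⟧ τ)

      τ*-pre : PreDefinable τ*
      τ*-pre = star-preDefinable (step-definable τ)

    module _ (T : FinLTS nA) where
      open FinLTS T
      open FiniteSystem τ T

      -- Induction on `n`. Moves of the finite system give finite unions and intersections, and
      -- moves of `T⟦ G ⟧` give preimages or, dually, boxes.
      approx-definable : ∀ n s → Definable (λ ν → Approx T⟦ G ⟧ L n ν s)
      approx-definable zero    s = definable-const (yes _)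
      approx-definable (suc n) s = definable-∩
        (definable-∀ nA λ a → definable-□ (weakly-preDefinable a)
          (definable-∃ m λ t → definable-∩ (definable-const (weakly? a s t)) (approx-definable n t)))
        (definable-∀ nA λ a → definable-∀ m λ t →
          definable-→ (weakly? a s t) (weakly-preDefinable a (approx-definable n t)))

      matched-definable : ∀ n → Definable (Matched T⟦ G ⟧ L n)
      matched-definable n = definable-□ (star-preDefinable anyStep-definable)
        (definable-∃ m λ t → approx-definable n t)

      bisimilar-definable : ∀ s → Definable (λ ν → Approx T⟦ G ⟧ L (proj₁ approx-stabilises) ν s
                                                 × Matched T⟦ G ⟧ L (suc (proj₁ approx-stabilises)) ν)
      bisimilar-definable s = definable-∩ (approx-definable _ s) (matched-definable _)

theorem4 : ∀ {nA : ℕ} (τ : Fin nA) (G : GCS nA) (T : FinLTS nA) (s : Fin (FinLTS.m T)) →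
    Σ (GapFormula (GCS.nV G) (GCS.nC G)) λ φ →
    ∀ (ν : Val (GCS.nV G)) → Sat (GCS.consts G) ν φ ⇔ WeakBisimilar τ G T ν s
theorem4 τ G T s = formula dnf , λ ν →
  bisimilar⇔ T⟦ G ⟧ L k stable ν s ⇔-∘ (correct ν ⇔-∘ formula-correct ν dnf)
  where
  open GCS G
  open GapDefinable {nV} consts
  open WeakBisimulation τ
  open FiniteSystem τ T
  open GapSystem G
  -- `k` is computed from `τ` and `T` alone, independently of `ν`, so one formula serves all
  -- valuations.
  k = proj₁ approx-stabilises
  stable = proj₂ approx-stabilises
  open Definable (bisimilar-definable τ T s)
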